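{- Let $\mathcal{C}$ be a class of ontologies such that $\textsc{cert-eval}[\mathcal{C}]$ is decidable. Then $\textsc{cert-eval}[\mathsf{Dyadic}\text{ - }\mathcal{C}]$ is decidable.
   Context: A TGD is $\sigma:\Phi(\mathbf{x},\mathbf{y})\to\exists\mathbf{z}\,\Psi(\mathbf{x},\mathbf{z})$ with body $\Phi$, head $\Psi$, existential variables $\mathrm{exvars}(\sigma)=\mathbf{z}$, frontier $\mathbf{x}$; an ontology is a finite set of TGDs. $\textsc{cert-eval}[\mathcal{C}]$: given a database $D$, $\Sigma\in\mathcal{C}$, a CQ $q(\mathbf{x})$ and constant tuple $\mathbf{c}$, decide whether $\mathbf{c}\in q(M)$ for every model $M\supseteq D$ of $\Sigma$. Affected positions: for existential variable $z$, a position $\pi$ is $z$-affected if some rule has $z$ in its head at $\pi$, or some rule has a frontier variable in its head at $\pi$ occurring in its body only at $z$-affected positions; $\mathrm{aff}(\pi)$ is the set of such $z$. A body variable at positions $\pi_1,\dots,\pi_n$ is harmless if $\bigcap_i\mathrm{aff}(\pi_i)=\emptyset$, harmful otherwise; a harmful frontier variable is dangerous. For $\sigma\in\Sigma$, a body atom is $\sigma$-problematic if it contains a dangerous variable or shares a harmful variable with a $\sigma$-problematic atom; $\mathrm{p\text{ - }atoms}(\sigma)$ are these, $\mathrm{s\text{ - }atoms}(\sigma)$ the rest. $\mathrm{HF}(\sigma)$ = harmless frontier variables in $\mathrm{s\text{ - }atoms}(\sigma)$; $\mathrm{bridge}(\sigma)=(\mathrm{vars}(\mathrm{p\text{ - }atoms}(\sigma))\cap\mathrm{vars}(\mathrm{s\text{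 - }atoms}(\sigma)))\cup\mathrm{HF}(\sigma)$. With a fresh predicate $\mathrm{Aux}_\sigma$: $\mathrm{main}(\sigma):\mathrm{Aux}_\sigma(\mathrm{bridge}(\sigma)),\mathrm{p\text{ - }atoms}(\sigma)\to\exists\,\mathrm{exvars}(\sigma)\,\mathrm{head}(\sigma)$ and $\mathrm{main}(\Sigma)=\bigcup_{\sigma\in\Sigma}\mathrm{main}(\sigma)$. $\Sigma\in\mathsf{Dyadic}\text{ - }\mathcal{C}$ iff $\Sigma\in\mathcal{C}$ or $\mathrm{main}(\Sigma)\in\mathcal{C}$. -}

module Defs where

open import Level using (Level; 0ℓ; _⊔_) renaming (suc to lsuc)
open import Data.Nat using (ℕ; zero; suc; _≤_; s≤s)
open import Data.Nat.Properties using (≤-refl; ≤-trans; ≤-reflexive) renaming (_≟_ to _≟ⁿ_)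
open import Data.Fin using (Fin) renaming (_≟_ to _≟ᶠ_)
open import Data.Vec using (Vec; lookup; fromList; toList) renaming (map to mapᵛ)
import Data.Vec.Properties as Vecₚ
open import Data.List using (List; []; _∷_; _++_; [_]; map; concatMap; filter; deduplicate; allFin; length)
open import Data.List.Properties using (length-++-sucʳ)
open import Data.List.Membership.Propositional using (_∈_; find; lose)
open import Data.List.Membership.Propositional.Properties
  using (∈-∃++; ∈-filter⁻; ∈-++⁻; ∈-++⁺ˡ; ∈-++⁺ʳ; ∈-concatMap⁺)
import Data.List.Membership.DecPropositional as DecMembership
open import Data.List.Relation.Unary.All using (All; []; _∷_; all?)
import Data.List.Relation.Unary.All as All
open import Data.List.Relation.Unary.Any using (Any; here; there; any?)
import Data.List.Relation.Unary.Any as Any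
open import Data.Product using (∃; _×_; _,_; proj₁; proj₂)
import Data.Product.Properties as Productₚ
open import Data.Sum using (_⊎_; inj₁; inj₂; [_,_]′)
open import Function using (_∘_; id)
open import Relation.Nullary using (Dec; yes; no; ¬_; ¬?; contradiction)
open import Relation.Nullary.Decidable using (map′; _×-dec_; _⊎-dec_)
open import Relation.Binary.Definitions using (DecidableEquality)
open import Relation.Binary.PropositionalEquality using (_≡_; _≢_; refl; sym; cong)

------------------------------------------------------------------------
-- Atoms, databases, instances

Const Null Var : Set
Const = ℕ
Null  = ℕ
Var   = ℕ

record Pred : Set where
  constructor _/_
  field
    name  : ℕ
    arity : ℕ
open Pred public

record Atom (T : Set) : Set where
  constructor atom
  field
    pred : Pred
    args : Vec T (arity pred)
open Atom public

mapAtom : {S T : Set} → (S → T) → Atom S → Atom T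
mapAtom f (atom p ts) = atom p (mapᵛ f ts)

data Term : Set where
  const : Const → Term
  var   : Var → Term

data Ground : Set where
  const : Const → Ground
  null  : Null → Ground

Database : Set
Database = List (Atom Const)

-- Instances, in particular models, may be infinite.
Instance : Set₁
Instance = Atom Ground → Set

_⊆ᴰ_ : Database → Instance → Set
D ⊆ᴰ M = All (λ α → M (mapAtom const α)) D

Assignment : Set
Assignment = Var → Ground

_⟪_⟫ : Assignment → Term → Ground
h ⟪ const c ⟫ = const c
h ⟪ var v ⟫   = h v

-- h maps the conjunction φ into M.
_maps_into_ : Assignment → List (Atom Term) → Instance → Set
h maps φ into M = All (λ α → M (mapAtom (h ⟪_⟫) α)) φ

termVars : Term → List Var
termVars (const _) = []
termVars (var v)   = [ v ]

atomVars : Atom Term → List Var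
atomVars α = concatMap termVars (toList (args α))

vars : List (Atom Term) → List Var
vars = concatMap atomVars

------------------------------------------------------------------------
-- Decidable equalities

_≟ᵖ_ : DecidableEquality Pred
(m / a) ≟ᵖ (n / b) =
  map′ (λ { (refl , refl) → refl }) (λ { refl → refl , refl }) ((m ≟ⁿ n) ×-dec (a ≟ⁿ b))

_≟ᵗ_ : DecidableEquality Term
const c ≟ᵗ const d = map′ (cong const) (λ { refl → refl }) (c ≟ⁿ d)
const _ ≟ᵗ var _   = no λ ()
var _   ≟ᵗ const _ = no λ ()
var v   ≟ᵗ var w   = map′ (cong var) (λ { refl → refl }) (v ≟ⁿ w)

_≟ᵃ_ : DecidableEquality (Atom Term)
atom p ts ≟ᵃ atom q us with p ≟ᵖ q
... | no p≢q   = no λ { refl → p≢q refl }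
... | yes refl =
  map′ (cong (atom p)) (λ { refl → refl }) (Vecₚ.≡-dec _≟ᵗ_ ts us)

open DecMembership _≟ⁿ_ using (_∈?_; _∉?_)
open DecMembership _≟ᵃ_ using () renaming (_∈?_ to _∈ᵃ?_)

------------------------------------------------------------------------
-- TGDs and their semantics

-- The prefix of quantifiers is left implicit: a variable of the head is
-- existential exactly when it does not occur in the body.
record TGD : Set where
  constructor _⟶_
  field
    body : List (Atom Term)
    head : List (Atom Term)
open TGD public

Ontology : Set
Ontology = List TGD

exvars frontier : TGD → List Var
exvars   σ = filter (_∉? vars (body σ)) (vars (head σ))
frontier σ = filter (_∈? vars (body σ)) (vars (head σ))

_⊨ᵣ_ : Instance → TGD → Set
M ⊨ᵣ σ = ∀ (h : Assignment) → h maps body σ into M →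
  ∃ λ (h′ : Assignment) → (∀ {v} → v ∈ frontier σ → h′ v ≡ h v) × (h′ maps head σ into M)

_⊨_ : Instance → Ontology → Set
M ⊨ Σ = ∀ {σ} → σ ∈ Σ → M ⊨ᵣ σ

------------------------------------------------------------------------
-- Conjunctive queries and certain answers

record CQ (n : ℕ) : Set where
  field
    answer : Vec Var n
    atoms  : List (Atom Term)
    safe   : ∀ {v} → v ∈ toList answer → v ∈ vars atoms
open CQ public

_∈_⟦_⟧ : {n : ℕ} → Vec Const n → CQ n → Instance → Set
c ∈ q ⟦ M ⟧ =
  ∃ λ (h : Assignment) → (mapᵛ h (answer q) ≡ mapᵛ const c) × (h maps atoms q into M)

CertainAnswer : {n : ℕ} → Database → Ontology → CQ n → Vec Const n → Set₁
CertainAnswer D Σ q c = ∀ (M : Instance) → D ⊆ᴰ M → M ⊨ Σ → c ∈ q ⟦ M ⟧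

OntologyClass : (ℓ : Level) → Set (lsuc ℓ)
OntologyClass ℓ = Ontology → Set ℓ

-- Decidability is the constructive one: a procedure that receives an instance
-- of the problem, including the evidence that its ontology is in 𝒞, and
-- returns a decision.
CertEvalDecidable : {ℓ : Level} → OntologyClass ℓ → Set (lsuc 0ℓ ⊔ ℓ)
CertEvalDecidable 𝒞 =
  ∀ (D : Database) (Σ : Ontology) → 𝒞 Σ →
  ∀ {n : ℕ} (q : CQ n) (c : Vec Const n) → Dec (CertainAnswer D Σ q c)

------------------------------------------------------------------------
-- Affected positions

Position : Set
Position = ∃ λ (p : Pred) → Fin (arity p)

_≟ᵒ_ : DecidableEquality Position
_≟ᵒ_ = Productₚ.≡-dec _≟ᵖ_ _≟ᶠ_

open DecMembership _≟ᵒ_ using () renaming (_∈?_ to _∈ᵒ?_)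

positionsIn : Var → Atom Term → List Position
positionsIn v α = map (pred α ,_) (filter (λ i → lookup (args α) i ≟ᵗ var v) (allFin _))

positions : Var → List (Atom Term) → List Position
positions v = concatMap (positionsIn v)

-- Variables are local to their rule, so an existential variable of an ontology
-- is a variable together with the rule that quantifies it.
ExVar : Set
ExVar = TGD × Var

exVars : Ontology → List ExVar
exVars = concatMap (λ σ → map (σ ,_) (exvars σ))

-- Affected Σ z π means that π is z-affected, i.e. z ∈ aff(π).
data Affected (Σ : Ontology) (z : ExVar) : Position → Set where
  invent : ∀ {π} → z ∈ exVars Σ → π ∈ positions (proj₂ z) (head (proj₁ z)) →
           Affected Σ z π
  propagate : ∀ {π σ v} → σ ∈ Σ → v ∈ frontier σ → π ∈ positions v (head σ) →
              (∀ {ρ} → ρ ∈ positions v (body σ) → Affected Σ z ρ) →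
              Affected Σ z π

-- For a body variable v of σ: the intersection of aff(π), over the positions π
-- of v in the body, is nonempty.
Harmful : Ontology → TGD → Var → Set
Harmful Σ σ v = Any (λ z → All (Affected Σ z) (positions v (body σ))) (exVars Σ)

Harmless : Ontology → TGD → Var → Set
Harmless Σ σ v = ¬ Harmful Σ σ v

Dangerous : Ontology → TGD → Var → Set
Dangerous Σ σ v = v ∈ frontier σ × Harmful Σ σ v

data Problematic (Σ : Ontology) (σ : TGD) : Atom Term → Set where
  dangerous : ∀ {α v} → α ∈ body σ → v ∈ atomVars α → Dangerous Σ σ v →
              Problematic Σ σ α
  shares : ∀ {α β v} → α ∈ body σ → Problematic Σ σ β →
           v ∈ atomVars α → v ∈ atomVars β → Harmful Σ σ v →
           Problematic Σ σ α

------------------------------------------------------------------------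
-- Affected and Problematic are decidable, by saturation over a finite
-- universe. This makes the decomposition of a rule computable.

module Saturation {A : Set} (I : A → Set)
  (Step : List A → A → Set) (step? : ∀ S x → Dec (Step S x))
  (U : List A) (_∈ᴬ?_ : ∀ (x : A) S → Dec (x ∈ S))
  (sound : ∀ {S x} → All I S → Step S x → I x)
  (complete : ∀ {S} → (∀ {x} → x ∈ U → Step S x → x ∈ S) → ∀ {x} → I x → x ∈ S)
  where

  saturate : ∀ n S R → length R ≤ n → All I S → (∀ {x} → x ∈ U → x ∈ S ⊎ x ∈ R) →
             ∃ λ S′ → All I S′ × (∀ {x} → x ∈ U → Step S′ x → x ∈ S′)
  saturate n S R R≤n IS cover with any? (step? S) R
  ... | no none = S , IS , λ x∈U st → [ id , (λ x∈R → contradiction (lose x∈R st) none) ]′ (cover x∈U)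
  ... | yes some with find some
  ...   | x , x∈R , st with ∈-∃++ x∈R
  saturate zero S .(ys ++ [ x ] ++ zs) R≤n IS cover | yes some | x , x∈R , st | ys , zs , refl
    with () ← ≤-trans (≤-reflexive (sym (length-++-sucʳ ys x zs))) R≤n
  saturate (suc n) S .(ys ++ [ x ] ++ zs) R≤n IS cover | yes some | x , x∈R , st | ys , zs , refl
    with s≤s R′≤n ← ≤-trans (≤-reflexive (sym (length-++-sucʳ ys x zs))) R≤n =
    saturate n (x ∷ S) (ys ++ zs) R′≤n (sound IS st ∷ IS) (λ y∈U → [ inj₁ ∘ there , move ]′ (cover y∈U))
    where
    move : ∀ {y} → y ∈ ys ++ [ x ] ++ zs → y ∈ x ∷ S ⊎ y ∈ ys ++ zs
    move y∈ with ∈-++⁻ ys y∈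
    ... | inj₁ y∈ys         = inj₂ (∈-++⁺ˡ y∈ys)
    ... | inj₂ (here eq)    = inj₁ (here eq)
    ... | inj₂ (there y∈zs) = inj₂ (∈-++⁺ʳ ys y∈zs)

  decide : ∀ x → Dec (I x)
  decide x with saturate (length U) [] U ≤-refl [] inj₂
  ... | S , IS , closed = map′ (All.lookup IS) (complete closed) (x ∈ᴬ? S)

-- One application of the rule propagate.
Propagates : Ontology → List Position → Position → Set
Propagates Σ S π =
  Any (λ σ → Any (λ v → π ∈ positions v (head σ) × All (_∈ S) (positions v (body σ)))
                 (frontier σ)) Σ

propagates? : ∀ Σ S π → Dec (Propagates Σ S π)
propagates? Σ S π = any? (λ σ → any? (λ v →
  (π ∈ᵒ? positions v (head σ)) ×-dec all? (_∈ᵒ? S) (positions v (body σ))) (frontier σ)) Σ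

headPositions : TGD → List Position
headPositions σ = concatMap (λ v → positions v (head σ)) (vars (head σ))

affected? : ∀ Σ z → z ∈ exVars Σ → ∀ π → Dec (Affected Σ z π)
affected? Σ z z∈Σ = Saturation.decide (Affected Σ z) Step step? U _∈ᵒ?_ sound complete
  where
  origin : List Position
  origin = positions (proj₂ z) (head (proj₁ z))

  Step : List Position → Position → Set
  Step S π = π ∈ origin ⊎ Propagates Σ S π

  step? : ∀ S π → Dec (Step S π)
  step? S π = (π ∈ᵒ? origin) ⊎-dec propagates? Σ S π

  U : List Position
  U = origin ++ concatMap headPositions Σ

  sound : ∀ {S π} → All (Affected Σ z) S → Step S π → Affected Σ z π
  sound IS (inj₁ π∈) = invent z∈Σ π∈
  sound IS (inj₂ p) with find p
  ... | σ , σ∈Σ , p′ with find p′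
  ... | v , v∈ , π∈ , all∈ = propagate σ∈Σ v∈ π∈ (All.lookup IS ∘ All.lookup all∈)

  complete : ∀ {S} → (∀ {π} → π ∈ U → Step S π → π ∈ S) → ∀ {π} → Affected Σ z π → π ∈ S
  complete closed (invent _ π∈) = closed (∈-++⁺ˡ π∈) (inj₁ π∈)
  complete closed (propagate {σ = σ} σ∈Σ v∈ π∈ aff) =
    closed (∈-++⁺ʳ origin (∈-concatMap⁺ headPositions
             (lose σ∈Σ (∈-concatMap⁺ (λ v → positions v (head σ))
               (lose (proj₁ (∈-filter⁻ (_∈? vars (body σ)) {xs = vars (head σ)} v∈)) π∈)))))
           (inj₂ (lose σ∈Σ (lose v∈ (π∈ , All.tabulate (λ ρ∈ → complete closed (aff ρ∈))))))

harmful? : ∀ Σ σ v → Dec (Harmful Σ σ v)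
harmful? Σ σ v = go (exVars Σ) id
  where
  go : ∀ zs → (∀ {z} → z ∈ zs → z ∈ exVars Σ) →
       Dec (Any (λ z → All (Affected Σ z) (positions v (body σ))) zs)
  go []       _   = no λ ()
  go (z ∷ zs) sub = map′ Any.fromSum Any.toSum
    (all? (affected? Σ z (sub (here refl))) (positions v (body σ)) ⊎-dec go zs (sub ∘ there))

dangerous? : ∀ Σ σ v → Dec (Dangerous Σ σ v)
dangerous? Σ σ v = (v ∈? frontier σ) ×-dec harmful? Σ σ v

problematic? : ∀ Σ σ α → Dec (Problematic Σ σ α)
problematic? Σ σ = Saturation.decide (Problematic Σ σ) Step step? (body σ) _∈ᵃ?_ sound complete
  where
  Step : List (Atom Term) → Atom Term → Set
  Step S α = α ∈ body σ ×
    Any (λ v → Dangerous Σ σ v ⊎ (Any (λ β → v ∈ atomVars β) S × Harmful Σ σ v)) (atomVars α)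

  step? : ∀ S α → Dec (Step S α)
  step? S α = (α ∈ᵃ? body σ) ×-dec any? (λ v →
    dangerous? Σ σ v ⊎-dec (any? (λ β → v ∈? atomVars β) S ×-dec harmful? Σ σ v)) (atomVars α)

  sound : ∀ {S α} → All (Problematic Σ σ) S → Step S α → Problematic Σ σ α
  sound IS (α∈ , p) with find p
  ... | v , v∈α , inj₁ d       = dangerous α∈ v∈α d
  ... | v , v∈α , inj₂ (b , h) with find b
  ... | β , β∈S , v∈β          = shares α∈ (All.lookup IS β∈S) v∈α v∈β h

  complete : ∀ {S} → (∀ {α} → α ∈ body σ → Step S α → α ∈ S) → ∀ {α} → Problematic Σ σ α → α ∈ S
  complete closed (dangerous α∈ v∈α d)     = closed α∈ (α∈ , lose v∈α (inj₁ d))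
  complete closed (shares α∈ pβ v∈α v∈β h) =
    closed α∈ (α∈ , lose v∈α (inj₂ (lose (complete closed pβ) v∈β , h)))

------------------------------------------------------------------------
-- The dyadic decomposition

p-atoms s-atoms : Ontology → TGD → List (Atom Term)
p-atoms Σ σ = filter (problematic? Σ σ) (body σ)
s-atoms Σ σ = filter (¬? ∘ problematic? Σ σ) (body σ)

HF : Ontology → TGD → List Var
HF Σ σ = filter (λ v → (v ∈? frontier σ) ×-dec ¬? (harmful? Σ σ v)) (vars (s-atoms Σ σ))

-- bridge(σ) is a set; the duplicate-free list fixes the order of the arguments
-- of Aux_σ.
bridge : Ontology → TGD → List Var
bridge Σ σ = deduplicate _≟ⁿ_
  (filter (_∈? vars (s-atoms Σ σ)) (vars (p-atoms Σ σ)) ++ HF Σ σ)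

-- A choice of the predicates Aux_σ: fresh for Σ and pairwise distinct.
record AuxChoice (Σ : Ontology) : Set where
  field
    auxName : TGD → ℕ

  Aux : TGD → Pred
  Aux σ = auxName σ / length (bridge Σ σ)

  field
    fresh    : ∀ {σ τ α} → σ ∈ Σ → τ ∈ Σ → α ∈ body τ ++ head τ → pred α ≢ Aux σ
    distinct : ∀ {σ τ} → σ ∈ Σ → τ ∈ Σ → Aux σ ≡ Aux τ → σ ≡ τ

module _ {Σ : Ontology} (𝒜 : AuxChoice Σ) where
  open AuxChoice 𝒜

  -- Every frontier variable of σ occurs in the new body, so the existential
  -- variables of mainᵣ σ are again exvars σ.
  mainᵣ : TGD → TGD
  mainᵣ σ = (atom (Aux σ) (mapᵛ var (fromList (bridge Σ σ))) ∷ p-atoms Σ σ) ⟶ head σ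

  main : Ontology
  main = map mainᵣ Σ

-- The auxiliary predicates are arbitrary fresh ones: Σ belongs to Dyadic 𝒞 if
-- main(Σ) belongs to 𝒞 for some choice of them.
Dyadic : {ℓ : Level} → OntologyClass ℓ → OntologyClass ℓ
Dyadic 𝒞 Σ = 𝒞 Σ ⊎ ∃ λ (𝒜 : AuxChoice Σ) → 𝒞 (main 𝒜)

{-# OPTIONS --safe #-}
module Submission where

-- The oracle for main(Σ) first completes D to a database D⁺, adding Aux_σ(c)
-- whenever c is a certain answer to the query s-atoms(σ) over main(Σ); the tuples
-- c range over the finitely many constants of D and Σ, so this terminates. Then
-- (D , Σ) and (D⁺ , main(Σ)) have the same certain answers.
-- * A model of D and Σ becomes one of D⁺ and main(Σ) by interpreting Aux_σ as
--   the projection of s-atoms(σ) to the bridge.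
-- * The chase of D with Σ maps into every model of D⁺ and main(Σ). Indeed a null
--   occurs only at positions affected by the variable that invented it, so a
--   trigger of σ sends the harmless bridge variables to constants; by induction
--   its s-atoms hold in every model of D⁺ and main(Σ), hence D⁺ contains the
--   Aux-atom that main(σ) needs.
-- Auxiliary predicates are fresh for Σ but may occur in D and in the query, where
-- all predicates foreign to Σ are therefore renamed first.
--
-- The chase is cut into finite stages, each a list of atoms: homomorphisms from
-- single stages suffice, so no choice of a homomorphism on the limit is needed.

open import Defs
open import Level using (Level)

open import Data.Nat using (ℕ; zero; suc; _+_; _∸_; _<_; _≤′_; ≤′-reflexive; ≤′-step; _⊔_; s≤s)
open import Data.Nat.Properties using (≤-refl; _<?_; m+n∸m≡n; m+n≮m; m≤m⊔n; m≤n⊔m; ≤⇒≤′; ≤-totalOrder)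
  renaming (_≟_ to _≟ⁿ_)
open import Data.Fin using (Fin)
import Data.Fin.Properties as Finₚ
open import Data.Vec using (Vec; []; _∷_; lookup; fromList; toList) renaming (map to mapᵛ)
open import Data.Vec.Properties using (lookup-map; map-∘; toList∘fromList; ≡-dec)
open import Data.Vec.Membership.Propositional.Properties using (∈-toList⁺; ∈-toList⁻)
  renaming (∈-lookup to ∈ᵛ-lookup)
open import Data.Vec.Relation.Unary.Any using () renaming (index to indexᵛ)
open import Data.Vec.Relation.Unary.Any.Properties using () renaming (lookup-index to lookup-indexᵛ)
open import Data.List using (List; []; _∷_; _++_; map; concatMap; filter; deduplicate; foldr;
                              allFin; length)
  renaming (lookup to lookupˡ)
open import Data.List.Properties using (concatMap-map)
open import Data.List.Extrema ≤-totalOrder using (max; xs≤max)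
open import Data.List.Membership.Propositional using (_∈_; find; lose)
open import Data.List.Membership.Propositional.Properties
  using (∈-map⁺; ∈-map⁻; ∈-filter⁺; ∈-filter⁻; ∈-++⁺ˡ; ∈-++⁺ʳ; ∈-++⁻;
         ∈-concatMap⁺; ∈-concatMap⁻; ∈-deduplicate⁺; ∈-deduplicate⁻; ∈-allFin; ∈-lookup)
import Data.List.Membership.DecPropositional as DecMembership
open import Data.List.Relation.Binary.Subset.Propositional using (_⊆_)
open import Data.List.Relation.Binary.Subset.Propositional.Properties using (++⁺ˡ; map⁺)
open import Data.List.Relation.Unary.All using (All; []; _∷_; all?)
import Data.List.Relation.Unary.All as All
import Data.List.Relation.Unary.All.Properties as Allₚ
open import Data.List.Relation.Unary.Any using (here; there; index)
open import Data.List.Relation.Unary.Any.Properties using (lookup-index)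
open import Data.Product using (∃; _×_; _,_; proj₁; proj₂)
open import Data.Sum using (_⊎_; inj₁; inj₂; [_,_]′)
open import Function using (_∘_; id)
open import Relation.Nullary using (Dec; yes; no; ¬_; ¬?; contradiction)
open import Relation.Nullary.Decidable
  using (map′; True; isYes; toWitness; fromWitness; T?; _×-dec_)
open import Relation.Binary.Definitions using (DecidableEquality)
open import Relation.Binary.PropositionalEquality
  using (_≡_; _≢_; refl; sym; trans; cong; subst)

open DecMembership _≟ⁿ_ using (_∈?_; _∉?_)
open DecMembership _≟ᵖ_ using () renaming (_∈?_ to _∈ᵖ?_)

private variable
  S T     : Set
  n       : ℕ
  v       : Var
  h g     : Assignment
  φ       : List (Atom Term)
  M       : Instance
  D F     : Database
  Σ       : Ontology
  σ       : TGD
  π       : Position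

-- Assignments and the variables of a conjunction

map-cong-∈ : {f f′ : S → T} (ts : Vec S n) → (∀ {t} → t ∈ toList ts → f t ≡ f′ t) →
             mapᵛ f ts ≡ mapᵛ f′ ts
map-cong-∈ []       eq = refl
map-cong-∈ (t ∷ ts) eq rewrite eq (here refl) | map-cong-∈ ts (eq ∘ there) = refl

mapAtom-cong : {f f′ : S → T} (α : Atom S) → (∀ {t} → t ∈ toList (args α) → f t ≡ f′ t) →
               mapAtom f α ≡ mapAtom f′ α
mapAtom-cong (atom p ts) eq = cong (atom p) (map-cong-∈ ts eq)

⟪⟫-cong : ∀ t → (∀ {v} → v ∈ termVars t → h v ≡ g v) → h ⟪ t ⟫ ≡ g ⟪ t ⟫
⟪⟫-cong (const _) eq = refl
⟪⟫-cong (var _)   eq = eq (here refl)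

∈-vars : {α : Atom Term} → α ∈ φ → v ∈ atomVars α → v ∈ vars φ
∈-vars α∈φ v∈α = ∈-concatMap⁺ atomVars (lose α∈φ v∈α)

∈-vars⁻ : ∀ φ → v ∈ vars φ → ∃ λ α → α ∈ φ × v ∈ atomVars α
∈-vars⁻ φ v∈φ = find (∈-concatMap⁻ atomVars {xs = φ} v∈φ)

mapAtom-⟪⟫-cong : (α : Atom Term) → (∀ {v} → v ∈ atomVars α → h v ≡ g v) →
                  mapAtom (h ⟪_⟫) α ≡ mapAtom (g ⟪_⟫) α
mapAtom-⟪⟫-cong α eq = mapAtom-cong α λ {t} t∈α →
  ⟪⟫-cong t (λ v∈t → eq (∈-concatMap⁺ termVars (lose t∈α v∈t)))

maps-cong : ∀ φ → (∀ {v} → v ∈ vars φ → h v ≡ g v) → h maps φ into M → g maps φ into M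
maps-cong {M = M} φ eq hφ = All.tabulate λ {α} α∈φ →
  subst M (mapAtom-⟪⟫-cong α (λ v∈α → eq (∈-vars α∈φ v∈α))) (All.lookup hφ α∈φ)

-- Homomorphisms between instances fix all constants, so they are represented by their values on
-- nulls.
extend : (Null → Ground) → Ground → Ground
extend e (const c) = const c
extend e (null k)  = e k

extend-⟪⟫ : ∀ e h t → (extend e ∘ h) ⟪ t ⟫ ≡ extend e (h ⟪ t ⟫)
extend-⟪⟫ e h (const _) = refl
extend-⟪⟫ e h (var _)   = refl

mapAtom-extend : ∀ e h α → mapAtom ((extend e ∘ h) ⟪_⟫) α ≡ mapAtom (extend e) (mapAtom (h ⟪_⟫) α)
mapAtom-extend e h (atom p ts) = cong (atom p) (trans (map-cong-∈ ts (λ {t} _ → extend-⟪⟫ e h t))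
                                                      (map-∘ (extend e) (h ⟪_⟫) ts))

∈-atomVars⁺ : (α : Atom Term) {j : Fin (arity (pred α))} →
              lookup (args α) j ≡ var v → v ∈ atomVars α
∈-atomVars⁺ {v = v} α {j} eq = ∈-concatMap⁺ termVars
  (lose (∈-toList⁺ (∈ᵛ-lookup j (args α))) (subst (λ t → v ∈ termVars t) (sym eq) (here refl)))

∈-atomVars⁻ : (α : Atom Term) → v ∈ atomVars α → ∃ λ j → lookup (args α) j ≡ var v
∈-atomVars⁻ α v∈α with find (∈-concatMap⁻ termVars {xs = toList (args α)} v∈α)
... | var _ , t∈α , here refl = indexᵛ (∈-toList⁻ t∈α) , sym (lookup-indexᵛ (∈-toList⁻ t∈α))

∈-positions⁺ : {α : Atom Term} → α ∈ φ → ∀ {j} → lookup (args α) j ≡ var v →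
               (pred α , j) ∈ positions v φ
∈-positions⁺ {v = v} {α} α∈φ {j} eq = ∈-concatMap⁺ (positionsIn v)
  (lose α∈φ (∈-map⁺ (pred α ,_) (∈-filter⁺ (λ i → lookup (args α) i ≟ᵗ var v) (∈-allFin j) eq)))

∈-positions⁻ : ∀ φ → π ∈ positions v φ →
  ∃ λ α → α ∈ φ × ∃ λ j → π ≡ (pred α , j) × lookup (args α) j ≡ var v
∈-positions⁻ {v = v} φ π∈ with find (∈-concatMap⁻ (positionsIn v) {xs = φ} π∈)
... | α , α∈φ , π∈α with ∈-map⁻ (pred α ,_) π∈α
... | j , j∈ , refl = α , α∈φ , j , refl ,
  proj₂ (∈-filter⁻ (λ i → lookup (args α) i ≟ᵗ var v) {xs = allFin _} j∈)

vars⇒positions : ∀ φ → v ∈ vars φ → ∃ λ π → π ∈ positions v φ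
vars⇒positions φ v∈φ with ∈-vars⁻ φ v∈φ
... | α , α∈φ , v∈α with ∈-atomVars⁻ α v∈α
... | j , eq = (pred α , j) , ∈-positions⁺ α∈φ eq

-- Finite enumeration of assignments

_≟ᵍ_ : DecidableEquality Ground
const c ≟ᵍ const d = map′ (cong const) (λ { refl → refl }) (c ≟ⁿ d)
const _ ≟ᵍ null _  = no λ ()
null _  ≟ᵍ const _ = no λ ()
null k  ≟ᵍ null l  = map′ (cong null) (λ { refl → refl }) (k ≟ⁿ l)

_≟ᵃᵍ_ : DecidableEquality (Atom Ground)
atom p ts ≟ᵃᵍ atom q us with p ≟ᵖ q
... | no p≢q   = no λ { refl → p≢q refl }
... | yes refl = map′ (cong (atom p)) (λ { refl → refl }) (≡-dec _≟ᵍ_ ts us)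

open DecMembership _≟ᵃᵍ_ using () renaming (_∈?_ to _∈ᵃᵍ?_)

_[_≔_] : (Var → T) → Var → T → Var → T
(f [ v ≔ t ]) w with w ≟ⁿ v
... | yes _ = t
... | no  _ = f w

assignments : T → List T → List Var → List (Var → T)
assignments d ts []       = (λ _ → d) ∷ []
assignments d ts (v ∷ vs) = concatMap (λ f → map (f [ v ≔_]) ts) (assignments d ts vs)

-- The listed maps take a default value outside `vs`, so `f` itself need not be listed; agreement on
-- `vs` is what can be had, and it determines the image of a conjunction over `vs`.
assignments-complete : ∀ (d : T) ts vs (f : Var → T) → (∀ {v} → v ∈ vs → f v ∈ ts) →
  ∃ λ f′ → f′ ∈ assignments d ts vs × (∀ {v} → v ∈ vs → f′ v ≡ f v)
assignments-complete d ts []       f f∈ = (λ _ → d) , here refl , λ ()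
assignments-complete d ts (v ∷ vs) f f∈ with assignments-complete d ts vs f (f∈ ∘ there)
... | f′ , f′∈ , eq = f′ [ v ≔ f v ] ,
  ∈-concatMap⁺ (λ f → map (f [ v ≔_]) ts) (lose f′∈ (∈-map⁺ (f′ [ v ≔_]) (f∈ (here refl)))) ,
  agree
  where
  agree : ∀ {w} → w ∈ v ∷ vs → (f′ [ v ≔ f v ]) w ≡ f w
  agree {w} w∈ with w ≟ⁿ v | w∈
  ... | yes refl | _          = refl
  ... | no w≢v   | here w≡v   = contradiction w≡v w≢v
  ... | no _     | there w∈vs = eq w∈vs

above : List ℕ → ℕ
above ks = suc (max 0 ks)

<above : ∀ {k ks} → k ∈ ks → k < above ks
<above {ks = ks} k∈ = s≤s (All.lookup (xs≤max 0 ks) k∈)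

frontier⁺ : ∀ σ → v ∈ vars (head σ) → v ∈ vars (body σ) → v ∈ frontier σ
frontier⁺ σ = ∈-filter⁺ (_∈? vars (body σ))

frontier⁻ : ∀ σ → v ∈ frontier σ → v ∈ vars (head σ) × v ∈ vars (body σ)
frontier⁻ σ = ∈-filter⁻ (_∈? vars (body σ)) {xs = vars (head σ)}

-- The bridge

module _ {P : Var → Set} (P? : ∀ v → Dec (P v)) (ps ss : List Var) where

  ∈-dedup-filters⁻ : v ∈ deduplicate _≟ⁿ_ (filter (_∈? ss) ps ++ filter P? ss) →
                     (v ∈ ps × v ∈ ss) ⊎ (v ∈ ss × P v)
  ∈-dedup-filters⁻ v∈
    with ∈-++⁻ (filter (_∈? ss) ps) (∈-deduplicate⁻ _≟ⁿ_ (filter (_∈? ss) ps ++ filter P? ss) v∈)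
  ... | inj₁ v∈ps = inj₁ (∈-filter⁻ (_∈? ss) {xs = ps} v∈ps)
  ... | inj₂ v∈HF = inj₂ (∈-filter⁻ P? {xs = ss} v∈HF)

  ∈-dedup-filters⁺ : (v ∈ ps × v ∈ ss) ⊎ (v ∈ ss × P v) →
                     v ∈ deduplicate _≟ⁿ_ (filter (_∈? ss) ps ++ filter P? ss)
  ∈-dedup-filters⁺ (inj₁ (v∈ps , v∈ss)) =
    ∈-deduplicate⁺ _≟ⁿ_ (∈-++⁺ˡ (∈-filter⁺ (_∈? ss) v∈ps v∈ss))
  ∈-dedup-filters⁺ (inj₂ (v∈ss , Pv))   =
    ∈-deduplicate⁺ _≟ⁿ_ (∈-++⁺ʳ (filter (_∈? ss) ps) (∈-filter⁺ P? v∈ss Pv))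

module _ {P : Atom Term → Set} (P? : ∀ α → Dec (P α)) where

  vars-filter⁺ : ∀ φ → v ∈ vars φ → v ∈ vars (filter P? φ) ⊎ ∃ λ α → α ∈ φ × v ∈ atomVars α × ¬ P α
  vars-filter⁺ φ v∈φ with ∈-vars⁻ φ v∈φ
  ... | α , α∈ , v∈α with P? α
  ... | yes Pα = inj₁ (∈-vars (∈-filter⁺ P? α∈ Pα) v∈α)
  ... | no ¬Pα = inj₂ (α , α∈ , v∈α , ¬Pα)

  vars-filter⁻ : ∀ φ → v ∈ vars (filter P? φ) → ∃ λ α → (α ∈ φ × P α) × v ∈ atomVars α
  vars-filter⁻ φ v∈ with ∈-vars⁻ (filter P? φ) v∈
  ... | α , α∈ , v∈α = α , ∈-filter⁻ P? {xs = φ} α∈ , v∈α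

  All-filter⁻ : ∀ φ {Q : Atom Term → Set} →
                All Q (filter P? φ) → All Q (filter (¬? ∘ P?) φ) → All Q φ
  All-filter⁻ φ {Q} qs rs = All.tabulate go
    where
    go : ∀ {α} → α ∈ φ → Q α
    go {α} α∈ with P? α
    ... | yes Pα = All.lookup qs (∈-filter⁺ P? α∈ Pα)
    ... | no ¬Pα = All.lookup rs (∈-filter⁺ (¬? ∘ P?) α∈ ¬Pα)

module _ (Σ : Ontology) (σ : TGD) where

  BridgeVar : Var → Set
  BridgeVar v = (v ∈ vars (p-atoms Σ σ) × v ∈ vars (s-atoms Σ σ)) ⊎
                (v ∈ vars (s-atoms Σ σ) × v ∈ frontier σ × Harmless Σ σ v)

  ∈-bridge⁻ : v ∈ bridge Σ σ → BridgeVar v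
  ∈-bridge⁻ = ∈-dedup-filters⁻ (λ v → (v ∈? frontier σ) ×-dec ¬? (harmful? Σ σ v))
                (vars (p-atoms Σ σ)) (vars (s-atoms Σ σ))

  ∈-bridge⁺ : BridgeVar v → v ∈ bridge Σ σ
  ∈-bridge⁺ = ∈-dedup-filters⁺ (λ v → (v ∈? frontier σ) ×-dec ¬? (harmful? Σ σ v))
                (vars (p-atoms Σ σ)) (vars (s-atoms Σ σ))

  bridge⊆s-atoms : v ∈ bridge Σ σ → v ∈ vars (s-atoms Σ σ)
  bridge⊆s-atoms = [ proj₂ , proj₁ ]′ ∘ ∈-bridge⁻

  bridge⊆body : v ∈ bridge Σ σ → v ∈ vars (body σ)
  bridge⊆body v∈ =
    let α , (α∈ , _) , v∈α = vars-filter⁻ (¬? ∘ problematic? Σ σ) (body σ) (bridge⊆s-atoms v∈)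
    in ∈-vars α∈ v∈α

  p-vars⊆body : v ∈ vars (p-atoms Σ σ) → v ∈ vars (body σ)
  p-vars⊆body v∈ =
    let α , (α∈ , _) , v∈α = vars-filter⁻ (problematic? Σ σ) (body σ) v∈
    in ∈-vars {φ = body σ} α∈ v∈α

  -- A harmful variable of an s-atom is not shared with a p-atom, as it would
  -- make the s-atom problematic.
  bridge-harmless : v ∈ bridge Σ σ → Harmless Σ σ v
  bridge-harmless {v} = [ shared , proj₂ ∘ proj₂ ]′ ∘ ∈-bridge⁻
    where
    shared : v ∈ vars (p-atoms Σ σ) × v ∈ vars (s-atoms Σ σ) → Harmless Σ σ v
    shared (v∈p , v∈s) harm =
      let β , (_  , pβ)  , v∈β = vars-filter⁻ (problematic? Σ σ) (body σ) v∈p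
          α , (α∈ , ¬pα) , v∈α = vars-filter⁻ (¬? ∘ problematic? Σ σ) (body σ) v∈s
      in ¬pα (shares α∈ pβ v∈α v∈β harm)

  -- A frontier variable in an s-atom is harmless, since otherwise it would be dangerous and make
  -- that atom problematic; so it belongs to `HF`.
  frontier⊆bridge∪p-atoms : v ∈ frontier σ → v ∈ bridge Σ σ ⊎ v ∈ vars (p-atoms Σ σ)
  frontier⊆bridge∪p-atoms {v} v∈ =
    [ inj₂ , inj₁ ∘ harmless ]′ (vars-filter⁺ (problematic? Σ σ) (body σ) (proj₂ (frontier⁻ σ v∈)))
    where
    harmless : (∃ λ α → α ∈ body σ × v ∈ atomVars α × ¬ Problematic Σ σ α) → v ∈ bridge Σ σ
    harmless (α , α∈ , v∈α , ¬pα) = ∈-bridge⁺ {v} (inj₂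
      ( ∈-vars {φ = s-atoms Σ σ} (∈-filter⁺ (¬? ∘ problematic? Σ σ) α∈ ¬pα) v∈α
      , v∈ , λ harm → ¬pα (dangerous α∈ v∈α (v∈ , harm))))

  p-atoms⊆body : p-atoms Σ σ ⊆ body σ
  p-atoms⊆body α∈ = proj₁ (∈-filter⁻ (problematic? Σ σ) {xs = body σ} α∈)

  s-atoms⊆body : s-atoms Σ σ ⊆ body σ
  s-atoms⊆body α∈ = proj₁ (∈-filter⁻ (¬? ∘ problematic? Σ σ) {xs = body σ} α∈)

  maps-body : h maps p-atoms Σ σ into M → h maps s-atoms Σ σ into M → h maps body σ into M
  maps-body = All-filter⁻ (problematic? Σ σ) (body σ)

  -- The certain answers to this query over main(Σ) are the tuples that the completed database
  -- stores under `Aux`.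
  s-query : CQ (length (bridge Σ σ))
  s-query = record
    { answer = fromList (bridge Σ σ)
    ; atoms  = s-atoms Σ σ
    ; safe   = λ {v} v∈ → bridge⊆s-atoms (subst (v ∈_) (toList∘fromList (bridge Σ σ)) v∈)
    }

map-var-vars : (xs : List Var) → concatMap termVars (toList (mapᵛ var (fromList xs))) ≡ xs
map-var-vars []       = refl
map-var-vars (x ∷ xs) = cong (x ∷_) (map-var-vars xs)

map-cong-fromList : {f f′ : S → T} (xs : List S) → (∀ {x} → x ∈ xs → f x ≡ f′ x) →
                    mapᵛ f (fromList xs) ≡ mapᵛ f′ (fromList xs)
map-cong-fromList xs eq =
  map-cong-∈ (fromList xs) λ {x} x∈ → eq (subst (x ∈_) (toList∘fromList xs) x∈)

map-≡⇒∈ : {f f′ : S → T} (xs : List S) → mapᵛ f (fromList xs) ≡ mapᵛ f′ (fromList xs) →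
          ∀ {x} → x ∈ xs → f x ≡ f′ x
map-≡⇒∈ (x ∷ xs) eq (here refl) = cong Data.Vec.head eq
map-≡⇒∈ (x ∷ xs) eq (there x∈)  = map-≡⇒∈ xs (cong Data.Vec.tail eq) x∈

-- The chase

terms : List (Atom Ground) → List Ground
terms = concatMap (toList ∘ args)

nullsOf : Ground → List Null
nullsOf (const _) = []
nullsOf (null k)  = k ∷ []

fresh : List (Atom Ground) → Null
fresh I = above (concatMap nullsOf (terms I))

null<fresh : ∀ {k} I → null k ∈ terms I → k < fresh I
null<fresh I k∈ = <above (∈-concatMap⁺ nullsOf (lose k∈ (here refl)))

-- The offset `fresh I` keeps the new nulls apart from those of `I`, and subtracting it recovers the
-- existential variable.
witness : List (Atom Ground) → TGD → Assignment → Assignment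
witness I σ h v with v ∈? vars (body σ)
... | yes _ = h v
... | no  _ = null (fresh I + v)

fire : List (Atom Ground) → TGD → Assignment → List (Atom Ground)
fire I σ h = map (mapAtom (witness I σ h ⟪_⟫)) (head σ) ++ I

-- The oblivious chase: a trigger may fire even if its head is already satisfied, and may fire
-- again.
data Chase (D : Database) (Σ : Ontology) : List (Atom Ground) → Set where
  start : Chase D Σ (map (mapAtom const) D)
  step  : ∀ {I σ h} → Chase D Σ I → σ ∈ Σ → h maps body σ into (_∈ I) → Chase D Σ (fire I σ h)

maps⇒∈terms : ∀ {I} φ → h maps φ into (_∈ I) → v ∈ vars φ → h v ∈ terms I
maps⇒∈terms {h} {v} {I} φ hφ v∈ with ∈-vars⁻ φ v∈
... | α , α∈ , v∈α with ∈-atomVars⁻ α v∈α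
... | j , eq = ∈-concatMap⁺ (toList ∘ args) (lose (All.lookup hφ α∈)
  (subst (_∈ toList (mapᵛ (h ⟪_⟫) (args α)))
    (trans (lookup-map j (h ⟪_⟫) (args α)) (cong (h ⟪_⟫) eq))
    (∈-toList⁺ (∈ᵛ-lookup j (mapᵛ (h ⟪_⟫) (args α))))))

-- Where constants and nulls occur in the chase

termConsts : Term → List Const
termConsts (const c) = c ∷ []
termConsts (var _)   = []

headConsts : TGD → List Const
headConsts σ = concatMap (λ α → concatMap termConsts (toList (args α))) (head σ)

-- Constants enter the chase only through the database and the rule heads.
adom : Database → Ontology → List Const
adom D Σ = concatMap (toList ∘ args) D ++ concatMap headConsts Σ

-- o assigns to each null the existential variable that invented it.
data Admissible (D : Database) (Σ : Ontology) (o : Null → ExVar) (π : Position) : Ground → Set where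
  const : ∀ {c} → c ∈ adom D Σ → Admissible D Σ o π (const c)
  null  : ∀ {k} → o k ∈ exVars Σ → Affected Σ (o k) π → Admissible D Σ o π (null k)

AdmissibleAtom : (D : Database) (Σ : Ontology) (o : Null → ExVar) → Atom Ground → Set
AdmissibleAtom D Σ o α = ∀ j → Admissible D Σ o (pred α , j) (lookup (args α) j)

admissible-body : ∀ {o I} φ → All (AdmissibleAtom D Σ o) I → h maps φ into (_∈ I) →
                  π ∈ positions v φ → Admissible D Σ o π (h v)
admissible-body {D} {Σ} {h = h} {v = v} {o} φ adm hφ π∈ with ∈-positions⁻ φ π∈
... | α , α∈ , j , refl , eq =
  subst (Admissible D Σ o (pred α , j)) (trans (lookup-map j (h ⟪_⟫) (args α)) (cong (h ⟪_⟫) eq))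
    (All.lookup adm (All.lookup hφ α∈) j)

-- Nulls of `I` lie below `fresh I` and keep their inventor; a new null `fresh I + v` gets the
-- inventor `(σ , v)`. The two rules for affected positions then match the two kinds of head
-- variables.
admissible-fire : ∀ {o I} → σ ∈ Σ → h maps body σ into (_∈ I) → All (AdmissibleAtom D Σ o) I →
                  ∃ λ o′ → All (AdmissibleAtom D Σ o′) (fire I σ h)
admissible-fire {σ} {Σ} {h} {D} {o} {I} σ∈ hb adm =
  o′ , Allₚ.++⁺ (Allₚ.map⁺ (All.tabulate new)) (All.tabulate old)
  where
  o′ : Null → ExVar
  o′ k with k <? fresh I
  ... | yes _ = o k
  ... | no  _ = σ , k ∸ fresh I

  o′-old : ∀ {k} → k < fresh I → o′ k ≡ o k
  o′-old {k} k< with k <? fresh I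
  ... | yes _ = refl
  ... | no k≮ = contradiction k< k≮

  o′-new : ∀ v → o′ (fresh I + v) ≡ (σ , v)
  o′-new v with fresh I + v <? fresh I
  ... | yes p = contradiction p (m+n≮m (fresh I) v)
  ... | no _  = cong (σ ,_) (m+n∸m≡n (fresh I) v)

  keep : ∀ {π t} → t ∈ terms I → Admissible D Σ o π t → Admissible D Σ o′ π t
  keep t∈ (const c∈) = const c∈
  keep {π} t∈ (null {k} z∈ aff) with o′-old {k} (null<fresh I t∈)
  ... | eq = null (subst (_∈ exVars Σ) (sym eq) z∈) (subst (λ z → Affected Σ z π) (sym eq) aff)

  old : ∀ {α} → α ∈ I → AdmissibleAtom D Σ o′ α
  old {α} α∈ j = keep (∈-concatMap⁺ (toList ∘ args) (lose α∈ (∈-toList⁺ (∈ᵛ-lookup j (args α)))))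
                      (All.lookup adm α∈ j)

  -- All body positions of `v` serve for affectedness; one actual position is needed to learn that a
  -- constant lies in `adom`, or that the inventor of a null lies in `exVars Σ`.
  propagated : ∀ {v π t} → v ∈ frontier σ → π ∈ positions v (head σ) →
    (∀ {ρ} → ρ ∈ positions v (body σ) → Admissible D Σ o′ ρ t) → ∃ (_∈ positions v (body σ)) →
    Admissible D Σ o′ π t
  propagated {t = const c} v∈ π∈ all (ρ , ρ∈) with all ρ∈
  ... | const c∈ = const c∈
  propagated {t = null k} v∈ π∈ all (ρ , ρ∈) with all ρ∈
  ... | null z∈ _ = null z∈ (propagate σ∈ v∈ π∈ λ ρ∈ → affected (all ρ∈))
    where
    affected : ∀ {ρ} → Admissible D Σ o′ ρ (null k) → Affected Σ (o′ k) ρ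
    affected (null _ aff) = aff

  new : ∀ {α} → α ∈ head σ → AdmissibleAtom D Σ o′ (mapAtom (witness I σ h ⟪_⟫) α)
  new {α} α∈ j rewrite lookup-map j (witness I σ h ⟪_⟫) (args α) with lookup (args α) j in eq
  ... | const c = const (∈-++⁺ʳ (concatMap (toList ∘ args) D) (∈-concatMap⁺ headConsts (lose σ∈
    (∈-concatMap⁺ (λ α → concatMap termConsts (toList (args α))) (lose α∈ (∈-concatMap⁺ termConsts
      (lose (∈-toList⁺ (∈ᵛ-lookup j (args α)))
        (subst (λ t → c ∈ termConsts t) (sym eq) (here refl)))))))))
  ... | var v with v ∈? vars (body σ)
  ... | yes v∈ = propagated (∈-filter⁺ (_∈? vars (body σ)) (∈-vars α∈ (∈-atomVars⁺ α eq)) v∈)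
                   (∈-positions⁺ α∈ eq)
                   (λ ρ∈ → keep (maps⇒∈terms (body σ) hb v∈) (admissible-body (body σ) adm hb ρ∈))
                   (vars⇒positions (body σ) v∈)
  ... | no v∉ = null
    (subst (_∈ exVars Σ) (sym (o′-new v)) z∈)
    (subst (λ z → Affected Σ z (pred α , j)) (sym (o′-new v)) (invent z∈ (∈-positions⁺ α∈ eq)))
    where
    z∈ : (σ , v) ∈ exVars Σ
    z∈ = ∈-concatMap⁺ (λ σ → map (σ ,_) (exvars σ)) (lose σ∈ (∈-map⁺ (σ ,_)
           (∈-filter⁺ (_∉? vars (body σ)) (∈-vars α∈ (∈-atomVars⁺ α eq)) v∉)))

chase-admissible : ∀ {I} → Chase D Σ I → ∃ λ o → All (AdmissibleAtom D Σ o) I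
-- Database atoms contain no nulls, so an arbitrary inventor map will do.
chase-admissible {D} {Σ} start = (λ _ → (([] ⟶ []) , 0)) , Allₚ.map⁺ (All.tabulate initial)
  where
  initial : ∀ {α o} → α ∈ D → AdmissibleAtom D Σ o (mapAtom const α)
  initial {α} α∈ j rewrite lookup-map j (Ground.const) (args α) =
    const (∈-++⁺ˡ (∈-concatMap⁺ (toList ∘ args) (lose α∈ (∈-toList⁺ (∈ᵛ-lookup j (args α))))))
chase-admissible (step ch σ∈ hb) = admissible-fire σ∈ hb (proj₂ (chase-admissible ch))

-- If `v` were sent to a null, the inventor of that null would affect every body position of `v`,
-- making `v` harmful.
harmless-constant : ∀ {I} → Chase D Σ I → h maps body σ into (_∈ I) → v ∈ vars (body σ) →
                    Harmless Σ σ v → ∃ λ c → c ∈ adom D Σ × h v ≡ const c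
harmless-constant {D} {Σ} {h} {σ} {v} ch hb v∈ harmless
  with o , adm ← chase-admissible ch | ρ , ρ∈ ← vars⇒positions (body σ) v∈ =
  go (h v) (admissible-body (body σ) adm hb)
  where
  go : ∀ t → (∀ {π} → π ∈ positions v (body σ) → Admissible D Σ o π t) →
       ∃ λ c → c ∈ adom D Σ × t ≡ const c
  go (const c) all with all ρ∈
  ... | const c∈ = c , c∈ , refl
  go (null k) all with all ρ∈
  ... | null z∈ _ = contradiction (lose z∈ (All.tabulate (affected ∘ all))) harmless
    where
    affected : ∀ {π} → Admissible D Σ o π (null k) → Affected Σ (o k) π
    affected (null _ aff) = aff

-- Gluing two assignments

_++→_ : List Var → (Var → T) → (Var → T) → Var → T
(vs ++→ f) f′ v with v ∈? vs
... | yes _ = f v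
... | no  _ = f′ v

++→-∈ : ∀ vs {f f′ : Var → T} → v ∈ vs → (vs ++→ f) f′ v ≡ f v
++→-∈ {v = v} vs v∈ with v ∈? vs
... | yes _ = refl
... | no v∉ = contradiction v∈ v∉

++→-agree : ∀ vs {f f′ : Var → T} → (v ∈ vs → f v ≡ f′ v) → (vs ++→ f) f′ v ≡ f′ v
++→-agree {v = v} vs eq with v ∈? vs
... | yes v∈ = eq v∈
... | no _   = refl

-- The least set of indices closed under a monotone step

module _ {k : ℕ} (Step : List (Fin k) → Fin k → Set) where

  -- Derivations are kept as data in `Set`, the level that the invariant of `Saturation` requires;
  -- `derivable-rec` later replays them in each model separately, whereas truth in all models would
  -- live in `Set₁`.
  data Derivable : Fin k → Set where
    derive : ∀ {S i} → All Derivable S → Step S i → Derivable i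

  Closed : List (Fin k) → Set
  Closed S = ∀ {i} → Step S i → i ∈ S

  module _ {P : Fin k → Set} (P-step : ∀ {S i} → All P S → Step S i → P i) where

    derivable-rec  : ∀ {i} → Derivable i → P i
    derivable-rec* : ∀ {S} → All Derivable S → All P S
    derivable-rec (derive ds st) = P-step (derivable-rec* ds) st
    derivable-rec* []       = []
    derivable-rec* (d ∷ ds) = derivable-rec d ∷ derivable-rec* ds

  saturation : (∀ S i → Dec (Step S i)) → (∀ {S S′ i} → S ⊆ S′ → Step S i → Step S′ i) →
               ∃ λ S → All Derivable S × Closed S
  saturation step? mono =
    let S , ds , closed = saturate (length (allFin k)) [] (allFin k) ≤-refl [] inj₂
    in S , ds , λ {i} → closed (∈-allFin i)
    where
    open DecMembership (Finₚ._≟_ {k}) using () renaming (_∈?_ to _∈ᶠ?_)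

    complete : ∀ {S} → (∀ {i} → i ∈ allFin k → Step S i → i ∈ S) → ∀ {i} → Derivable i → i ∈ S
    complete closed = derivable-rec λ {_} {i} R⊆S st →
      closed (∈-allFin i) (mono (All.lookup R⊆S) st)

    open Saturation Derivable Step step? (allFin k) _∈ᶠ?_ derive complete using (saturate)

-- Fair chase sequences

Trigger : Set
Trigger = TGD × Assignment

fireAll : List (Atom Ground) → List Trigger → List (Atom Ground)
fireAll = foldr (λ (σ , h) I → fire I σ h)

fireAll-⊇ : ∀ {I} ts → I ⊆ fireAll I ts
fireAll-⊇ []             = id
fireAll-⊇ ((σ , h) ∷ ts) = ∈-++⁺ʳ (map _ (head σ)) ∘ fireAll-⊇ ts

-- Triggers found in `I` stay applicable while others fire, because instances only grow.
fireAll-chase : ∀ {I ts} → Chase D Σ I → All (λ (σ , h) → σ ∈ Σ × h maps body σ into (_∈ I)) ts →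
                Chase D Σ (fireAll I ts)
fireAll-chase ch []                          = ch
fireAll-chase ch (_∷_ {xs = ts} (σ∈ , hb) t) =
  step (fireAll-chase ch t) σ∈ (All.map (fireAll-⊇ ts) hb)

witness-body : ∀ I σ → v ∈ vars (body σ) → witness I σ h v ≡ h v
witness-body {v} I σ v∈ with v ∈? vars (body σ)
... | yes _ = refl
... | no v∉ = contradiction v∈ v∉

fireAll-fires : ∀ {I ts} → (σ , h) ∈ ts →
  ∃ λ h′ → (∀ {v} → v ∈ vars (body σ) → h′ v ≡ h v) × (h′ maps head σ into (_∈ fireAll I ts))
fireAll-fires {σ} {h} {I} {_ ∷ ts} (here refl) =
  witness (fireAll I ts) σ h , witness-body (fireAll I ts) σ ,
  All.tabulate (λ α∈ → ∈-++⁺ˡ (∈-map⁺ (mapAtom (witness (fireAll I ts) σ h ⟪_⟫)) α∈))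
fireAll-fires {ts = (τ , _) ∷ _} (there t∈) =
  let h′ , eq , h′head = fireAll-fires t∈
  in h′ , eq , All.map (∈-++⁺ʳ (map _ (head τ))) h′head

maps-into? : ∀ I φ h → Dec (h maps φ into (_∈ I))
maps-into? I φ h = all? (λ α → mapAtom (h ⟪_⟫) α ∈ᵃᵍ? I) φ

-- Body variables can only take values among the terms of `I`. Elsewhere the value is the default
-- `null 0`, which `witness` replaces by fresh nulls.
matches : List (Atom Ground) → TGD → List Assignment
matches I σ = filter (maps-into? I (body σ)) (assignments (null 0) (terms I) (vars (body σ)))

triggers : Ontology → List (Atom Ground) → List Trigger
triggers Σ I = concatMap (λ σ → map (σ ,_) (matches I σ)) Σ

triggers-valid : ∀ {I} → All (λ (σ , h) → σ ∈ Σ × h maps body σ into (_∈ I)) (triggers Σ I)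
triggers-valid {Σ} {I} = All.tabulate valid
  where
  valid : ∀ {t} → t ∈ triggers Σ I → proj₁ t ∈ Σ × proj₂ t maps body (proj₁ t) into (_∈ I)
  valid t∈ with find (∈-concatMap⁻ (λ σ → map (σ ,_) (matches I σ)) {xs = Σ} t∈)
  ... | σ , σ∈ , t∈σ with ∈-map⁻ (σ ,_) t∈σ
  ... | h , h∈ , refl =
    σ∈ , proj₂ (∈-filter⁻ (maps-into? I (body σ))
      {xs = assignments (null 0) (terms I) (vars (body σ))} h∈)

triggers-complete : ∀ {I} → σ ∈ Σ → h maps body σ into (_∈ I) →
  ∃ λ h′ → (σ , h′) ∈ triggers Σ I × (∀ {v} → v ∈ vars (body σ) → h′ v ≡ h v)
triggers-complete {σ} {h = h} {I} σ∈ hb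
  with h′ , h′∈ , eq ← assignments-complete (null 0) (terms I) (vars (body σ)) h
                        (maps⇒∈terms (body σ) hb) =
  h′ ,
  ∈-concatMap⁺ (λ σ → map (σ ,_) (matches I σ)) (lose σ∈ (∈-map⁺ (σ ,_)
    (∈-filter⁺ (maps-into? I (body σ)) h′∈ (maps-cong {M = _∈ I} (body σ) (sym ∘ eq) hb)))) ,
  eq

module _ (D : Database) (Σ : Ontology) where

  stage : ℕ → List (Atom Ground)
  stage zero    = map (mapAtom const) D
  stage (suc i) = fireAll (stage i) (triggers Σ (stage i))

  stage-chase : ∀ i → Chase D Σ (stage i)
  stage-chase zero    = start
  stage-chase (suc i) = fireAll-chase (stage-chase i) triggers-valid

  stage-mono : ∀ {i j} → i ≤′ j → stage i ⊆ stage j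
  stage-mono (≤′-reflexive refl) = id
  stage-mono (≤′-step {j} i≤j)   = fireAll-⊇ (triggers Σ (stage j)) ∘ stage-mono i≤j

  limit : Instance
  limit α = ∃ λ i → α ∈ stage i

  -- A conjunction is finite, so the maximum of the stages of its atoms contains them all.
  maps-into-stage : ∀ φ → h maps φ into limit → ∃ λ i → h maps φ into (_∈ stage i)
  maps-into-stage []      []              = 0 , []
  maps-into-stage (α ∷ φ) ((i , α∈) ∷ hφ) =
    let j , hφ′ = maps-into-stage φ hφ
    in i ⊔ j , stage-mono (≤⇒≤′ (m≤m⊔n i j)) α∈ ∷ All.map (stage-mono (≤⇒≤′ (m≤n⊔m i j))) hφ′

  limit-database : D ⊆ᴰ limit
  limit-database = All.tabulate (λ α∈ → 0 , ∈-map⁺ (mapAtom const) α∈)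

  -- Fairness: a body match lies in some stage `i`, and every trigger of stage `i` is fired in
  -- passing to the next one.
  limit-model : limit ⊨ Σ
  limit-model {σ} σ∈ h hb =
    let i  , hb′             = maps-into-stage (body σ) hb
        h′ , t∈ , h′≡h       = triggers-complete σ∈ hb′
        h″ , h″≡h′ , h″head  = fireAll-fires {I = stage i} t∈
    in h″ ,
       (λ v∈ → let v∈b = proj₂ (frontier⁻ σ v∈) in trans (h″≡h′ v∈b) (h′≡h v∈b)) ,
       All.map (suc i ,_) h″head

-- The chase is universal

extend-maps : ∀ M φ {e I} → All (M ∘ mapAtom (extend e)) I → h maps φ into (_∈ I) →
              (extend e ∘ h) maps φ into M
extend-maps {h} M φ {e} eI = All.map λ {α} α∈I →
  subst M (sym (mapAtom-extend e h α)) (All.lookup eI α∈I)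

-- The homomorphism is kept on old nulls and sends `fresh I + v` to `h′ v`; agreement of `h′` with
-- it on the frontier makes the image of the new atoms the match of the head in `M`.
extend-fire : ∀ {e I h′} σ → h maps body σ into (_∈ I) → All (M ∘ mapAtom (extend e)) I →
              (∀ {v} → v ∈ frontier σ → h′ v ≡ extend e (h v)) → h′ maps head σ into M →
              ∃ λ e′ → All (M ∘ mapAtom (extend e′)) (fire I σ h)
extend-fire {h} {M} {e} {I} {h′} σ hb eI agree h′head =
  e′ , Allₚ.++⁺ (Allₚ.map⁺ (All.tabulate new)) (All.tabulate old)
  where
  e′ : Null → Ground
  e′ k with k <? fresh I
  ... | yes _ = e k
  ... | no  _ = h′ (k ∸ fresh I)

  e′-new : ∀ v → e′ (fresh I + v) ≡ h′ v
  e′-new v with fresh I + v <? fresh I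
  ... | yes p = contradiction p (m+n≮m (fresh I) v)
  ... | no _  = cong h′ (m+n∸m≡n (fresh I) v)

  e′-old : ∀ {t} → t ∈ terms I → extend e′ t ≡ extend e t
  e′-old {const _} _ = refl
  e′-old {null k}  t∈ with k <? fresh I
  ... | yes _ = refl
  ... | no k≮ = contradiction (null<fresh I t∈) k≮

  old : ∀ {α} → α ∈ I → M (mapAtom (extend e′) α)
  old {α} α∈ = subst M
    (sym (mapAtom-cong α λ t∈α → e′-old (∈-concatMap⁺ (toList ∘ args) (lose α∈ t∈α))))
    (All.lookup eI α∈)

  e′-witness : ∀ {v} → v ∈ vars (head σ) → h′ v ≡ extend e′ (witness I σ h v)
  e′-witness {v} v∈ with v ∈? vars (body σ)
  ... | yes v∈b = trans (agree (∈-filter⁺ (_∈? vars (body σ)) v∈ v∈b))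
                        (sym (e′-old (maps⇒∈terms (body σ) hb v∈b)))
  ... | no _    = sym (e′-new v)

  new : ∀ {α} → α ∈ head σ → M (mapAtom (extend e′) (mapAtom (witness I σ h ⟪_⟫) α))
  new {α} α∈ = subst M (mapAtom-extend e′ (witness I σ h) α)
    (All.lookup (maps-cong {M = M} (head σ) e′-witness h′head) α∈)

-- The value 0 at nulls is a default; on the bridge, `harmless-constant` excludes nulls.
constant : Ground → Const
constant (const c) = c
constant (null _)  = 0

⊨-map : {f : TGD → TGD} → (∀ {σ} → σ ∈ Σ → M ⊨ᵣ f σ) → M ⊨ map f Σ
⊨-map M⊨ σ∈ = All.lookup (Allₚ.map⁺ (All.tabulate M⊨)) σ∈

vars-bridge : ∀ k vs φ → v ∈ vs ⊎ v ∈ vars φ →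
              v ∈ vars (atom (k / length vs) (mapᵛ var (fromList vs)) ∷ φ)
vars-bridge {v} k vs φ (inj₁ v∈) = ∈-++⁺ˡ (subst (v ∈_) (sym (map-var-vars vs)) v∈)
vars-bridge     k vs φ (inj₂ v∈) =
  ∈-++⁺ʳ (atomVars (atom (k / length vs) (mapᵛ var (fromList vs)))) v∈

vars-bridge⁻ : ∀ k vs φ → v ∈ vars (atom (k / length vs) (mapᵛ var (fromList vs)) ∷ φ) →
               v ∈ vs ++ vars φ
vars-bridge⁻ {v} k vs φ v∈ = subst (λ us → v ∈ us ++ vars φ) (map-var-vars vs) v∈

module _ {Σ : Ontology} (𝒜 : AuxChoice Σ) where
  open AuxChoice 𝒜 using (auxName; Aux; distinct) renaming (fresh to aux-fresh)

  frontier⊆frontier-mainᵣ : ∀ σ → v ∈ frontier σ → v ∈ frontier (mainᵣ 𝒜 σ)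
  frontier⊆frontier-mainᵣ σ v∈ =
    frontier⁺ (mainᵣ 𝒜 σ) (proj₁ (frontier⁻ σ v∈))
      (vars-bridge (auxName σ) (bridge Σ σ) (p-atoms Σ σ) (frontier⊆bridge∪p-atoms Σ σ v∈))

  auxAtom : ∀ σ → (Var → T) → Atom T
  auxAtom σ f = atom (Aux σ) (mapᵛ f (fromList (bridge Σ σ)))

  -- Only tuples over `adom D Σ` are demanded, which leaves finitely many; `harmless-constant` shows
  -- that triggers of the chase produce no others on the bridge.
  Saturated : Database → Database → Set₁
  Saturated D F = ∀ {σ} → σ ∈ Σ → (f : Var → Const) → (∀ {v} → v ∈ bridge Σ σ → f v ∈ adom D Σ) →
    CertainAnswer F (main 𝒜) (s-query Σ σ) (mapᵛ f (fromList (bridge Σ σ))) → auxAtom σ f ∈ F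

  MapsInto : Database → Instance → List (Atom Ground) → Set
  MapsInto F M I = F ⊆ᴰ M → M ⊨ main 𝒜 → ∃ λ e → All (M ∘ mapAtom (extend e)) I

  -- The s-atoms of a trigger hold in the chase, hence, by universality for the
  -- smaller chase, in every model; so saturation supplies the Aux-atom.
  fire-universal : ∀ {I} → Saturated D F → Chase D Σ I → σ ∈ Σ → h maps body σ into (_∈ I) →
                   (∀ M → MapsInto F M I) → ∀ M → MapsInto F M (fire I σ h)
  fire-universal {D} {F} {σ} {h} {I} sat ch σ∈ hb universal M F⊆M M⊨ =
    let h′ , agree , h′head = rule
    in extend-fire {M = M} {h′ = h′} σ hb eI
         (λ {v} v∈ → agree {v} (frontier⊆frontier-mainᵣ {v} σ v∈)) h′head
    where
    e  = proj₁ (universal M F⊆M M⊨)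
    eI = proj₂ (universal M F⊆M M⊨)

    bs = fromList (bridge Σ σ)

    f : Var → Const
    f = constant ∘ h

    f-spec : ∀ {v} → v ∈ bridge Σ σ → f v ∈ adom D Σ × h v ≡ const (f v)
    f-spec {v} v∈ =
      let c , c∈ , eq = harmless-constant {σ = σ} {v = v} ch hb
                          (bridge⊆body Σ σ v∈) (bridge-harmless Σ σ v∈)
          c≡fv = sym (cong constant eq)
      in subst (_∈ adom D Σ) c≡fv c∈ , trans eq (cong const c≡fv)

    -- Bridge values are constants, which every homomorphism fixes, so the same tuple is obtained in
    -- every model.
    bridge-image : ∀ e → mapᵛ (extend e ∘ h) bs ≡ mapᵛ const (mapᵛ f bs)
    bridge-image e = trans
      (map-cong-fromList (bridge Σ σ) λ {v} v∈ → cong (extend e) (proj₂ (f-spec {v} v∈)))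
      (map-∘ const f bs)

    certain : CertainAnswer F (main 𝒜) (s-query Σ σ) (mapᵛ f bs)
    certain M′ F⊆M′ M′⊨ =
      let e′ , e′I = universal M′ F⊆M′ M′⊨
      in extend e′ ∘ h , bridge-image e′ ,
         extend-maps M′ (s-atoms Σ σ) {e′} e′I (Allₚ.anti-mono (s-atoms⊆body Σ σ) hb)

    aux : M (mapAtom ((extend e ∘ h) ⟪_⟫) (auxAtom σ var))
    aux = subst M (cong (atom (Aux σ)) (trans (sym (bridge-image e))
                                              (map-∘ ((extend e ∘ h) ⟪_⟫) var bs)))
      (All.lookup F⊆M (sat σ∈ f (proj₁ ∘ f-spec) certain))

    rule : ∃ λ h′ → (∀ {v} → v ∈ frontier (mainᵣ 𝒜 σ) → h′ v ≡ extend e (h v)) ×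
                    (h′ maps head σ into M)
    rule = M⊨ (∈-map⁺ (mainᵣ 𝒜) σ∈) (extend e ∘ h)
      (aux ∷ extend-maps M (p-atoms Σ σ) {e} eI (Allₚ.anti-mono (p-atoms⊆body Σ σ) hb))

  -- The model is quantified after the chase, so that the induction hypothesis covers all models at
  -- once, as `fire-universal` needs.
  chase-universal : ∀ {I} → D ⊆ F → Saturated D F → Chase D Σ I → ∀ M → MapsInto F M I
  -- Database atoms contain only constants; the identity on nulls serves as homomorphism.
  chase-universal D⊆F sat start M F⊆M M⊨ = null , Allₚ.map⁺ (All.tabulate λ {α} α∈ →
    subst M (cong (atom (pred α)) (map-∘ (extend null) const (args α))) (All.lookup F⊆M (D⊆F α∈)))
  chase-universal D⊆F sat (step ch σ∈ hb) = fire-universal sat ch σ∈ hb (chase-universal D⊆F sat ch)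

  -- The limit of the chase is a model of `D` and Σ, so it satisfies the query; the match lies in
  -- one stage, and that stage maps into `M` with constants fixed.
  saturated-complete : ∀ {q : CQ n} {c} → D ⊆ F → Saturated D F →
                       CertainAnswer D Σ q c → CertainAnswer F (main 𝒜) q c
  saturated-complete {D = D} {q = q} {c} D⊆F sat cert M F⊆M M⊨ =
    let h , eq , hq = cert (limit D Σ) (limit-database D Σ) (limit-model D Σ)
        i , hq′     = maps-into-stage D Σ (atoms q) hq
        e , eI      = chase-universal D⊆F sat (stage-chase D Σ i) M F⊆M M⊨
    in extend e ∘ h ,
       trans (map-∘ (extend e) h (answer q))
         (trans (cong (mapᵛ (extend e)) eq) (sym (map-∘ (extend e) const c))) ,
       extend-maps M (atoms q) {e} eI hq′

  -- Expanding a model of Σ by the auxiliary predicates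

  AuxFree : Atom T → Set
  AuxFree α = ∀ {σ} → σ ∈ Σ → pred α ≢ Aux σ

  -- Atoms of `M` that already use an auxiliary predicate are discarded: they could trigger rules of
  -- main(Σ) without a match of the s-atoms.
  data Expansion (M : Instance) : Instance where
    old : ∀ {α} → AuxFree α → M α → Expansion M α
    aux : σ ∈ Σ → h maps s-atoms Σ σ into M → Expansion M (auxAtom σ h)

  expansion-old⁻ : ∀ {α} → AuxFree α → Expansion M α → M α
  expansion-old⁻ free (old _ α∈M) = α∈M
  expansion-old⁻ free (aux σ∈ _)  = contradiction refl (free σ∈)

  atom-injective : ∀ {p} {ts us : Vec T (arity p)} → atom p ts ≡ atom p us → ts ≡ us
  atom-injective refl = refl

  -- Auxiliary predicates are pairwise distinct, so an Aux-atom of σ can only come from a match of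
  -- the s-atoms of σ. The separate equation on `α` permits case analysis on the expansion.
  expansion-aux⁻ : ∀ {α us} → σ ∈ Σ → Expansion M α → α ≡ atom (Aux σ) us →
    ∃ λ h → us ≡ mapᵛ h (fromList (bridge Σ σ)) × (h maps s-atoms Σ σ into M)
  expansion-aux⁻ σ∈ (old free _) eq = contradiction (cong pred eq) (free σ∈)
  expansion-aux⁻ {σ} {M} {us = us} σ∈ (aux {τ} {h} τ∈ hs) eq =
    same (distinct τ∈ σ∈ (cong pred eq)) hs eq
    where
    same : ∀ {τ} → τ ≡ σ → h maps s-atoms Σ τ into M → auxAtom τ h ≡ atom (Aux σ) us →
           ∃ λ h → us ≡ mapᵛ h (fromList (bridge Σ σ)) × (h maps s-atoms Σ σ into M)
    same refl hs eq = h , sym (atom-injective eq) , hs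

  maps-expansion⁻ : ∀ φ → All AuxFree φ → h maps φ into Expansion M → h maps φ into M
  maps-expansion⁻ []      []           []        = []
  maps-expansion⁻ (α ∷ φ) (free ∷ fs) (hα ∷ hφ) = expansion-old⁻ free hα ∷ maps-expansion⁻ φ fs hφ

  auxFree-body : ∀ φ → σ ∈ Σ → φ ⊆ body σ → All AuxFree φ
  auxFree-body φ σ∈ φ⊆ = All.tabulate λ α∈ τ∈ → aux-fresh τ∈ σ∈ (∈-++⁺ˡ (φ⊆ α∈))

  maps-head-expansion : σ ∈ Σ → h maps head σ into M → h maps head σ into Expansion M
  maps-head-expansion {σ} σ∈ hh = All.tabulate λ α∈ →
    old (λ τ∈ → aux-fresh τ∈ σ∈ (∈-++⁺ʳ (body σ) α∈)) (All.lookup hh α∈)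

  -- The Aux-atom yields a match `h₂` of the s-atoms that agrees with `h` on the bridge. Variables
  -- common to p-atoms and s-atoms lie in the bridge, so `h` on bridge and p-atoms glues with `h₂`
  -- to a match of the whole body, and σ applies in `M`.
  expansion-rule : σ ∈ Σ → M ⊨ᵣ σ → Expansion M ⊨ᵣ mainᵣ 𝒜 σ
  expansion-rule {σ} {M} σ∈ M⊨σ h (hA ∷ hp) =
    let h′ , agree , h′head = M⊨σ glued (maps-body Σ σ {h = glued} {M = M} glued-p glued-s)
    in h′ ,
       (λ {v} v∈ → trans (agree {v} (frontier-mainᵣ⊆frontier {v} v∈))
                         (glued≡h {v} (frontier-mainᵣ⊆vs {v} v∈))) ,
       maps-head-expansion σ∈ h′head
    where
    bs = bridge Σ σ
    vs = bs ++ vars (p-atoms Σ σ)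

    inverse : ∃ λ h₂ → mapᵛ (h ⟪_⟫) (mapᵛ var (fromList bs)) ≡ mapᵛ h₂ (fromList bs) ×
                       (h₂ maps s-atoms Σ σ into M)
    inverse = expansion-aux⁻ σ∈ hA refl

    h₂ = proj₁ inverse

    h≡h₂ : ∀ {v} → v ∈ bs → h v ≡ h₂ v
    h≡h₂ = map-≡⇒∈ bs (trans (map-∘ (h ⟪_⟫) var (fromList bs)) (proj₁ (proj₂ inverse)))

    glued : Assignment
    glued = (vs ++→ h) h₂

    glued≡h : ∀ {v} → v ∈ vs → glued v ≡ h v
    glued≡h = ++→-∈ vs

    glued-p : glued maps p-atoms Σ σ into M
    glued-p = maps-cong {h = h} {g = glued} {M = M} (p-atoms Σ σ)
            (λ v∈ → sym (glued≡h (∈-++⁺ʳ bs v∈)))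
            (maps-expansion⁻ (p-atoms Σ σ) (auxFree-body (p-atoms Σ σ) σ∈ (p-atoms⊆body Σ σ)) hp)

    shared : ∀ {v} → v ∈ vars (s-atoms Σ σ) → v ∈ vs → v ∈ bs
    shared {v} v∈s v∈vs = [ id , (λ v∈p → ∈-bridge⁺ Σ σ {v} (inj₁ (v∈p , v∈s))) ]′ (∈-++⁻ bs v∈vs)

    glued-s : glued maps s-atoms Σ σ into M
    glued-s = maps-cong {h = h₂} {g = glued} {M = M} (s-atoms Σ σ)
            (λ {v} v∈ → sym (++→-agree vs (λ v∈vs → h≡h₂ (shared {v} v∈ v∈vs))))
            (proj₂ (proj₂ inverse))

    frontier-mainᵣ⊆vs : ∀ {v} → v ∈ frontier (mainᵣ 𝒜 σ) → v ∈ vs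
    frontier-mainᵣ⊆vs {v} v∈ =
      vars-bridge⁻ (auxName σ) bs (p-atoms Σ σ) (proj₂ (frontier⁻ {v} (mainᵣ 𝒜 σ) v∈))

    frontier-mainᵣ⊆frontier : ∀ {v} → v ∈ frontier (mainᵣ 𝒜 σ) → v ∈ frontier σ
    frontier-mainᵣ⊆frontier {v} v∈ = frontier⁺ σ (proj₁ (frontier⁻ {v} (mainᵣ 𝒜 σ) v∈))
      ([ bridge⊆body Σ σ {v} , p-vars⊆body Σ σ {v} ]′ (∈-++⁻ bs (frontier-mainᵣ⊆vs {v} v∈)))

  expansion-model : M ⊨ Σ → Expansion M ⊨ main 𝒜
  expansion-model {M} M⊨ = ⊨-map {Σ = Σ} {M = Expansion M} {f = mainᵣ 𝒜}
    (λ σ∈ → expansion-rule σ∈ (M⊨ σ∈))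

  expansion-query⁻ : ∀ {q : CQ n} {c} → All AuxFree (atoms q) → c ∈ q ⟦ Expansion M ⟧ → c ∈ q ⟦ M ⟧
  expansion-query⁻ {q = q} free (h , eq , hq) = h , eq , maps-expansion⁻ (atoms q) free hq

  -- Saturation of a database with the certain Aux-atoms

  Candidate : Set
  Candidate = ∃ λ σ → Vec Const (length (bridge Σ σ))

  candidate : (σ : TGD) → (Var → Const) → Candidate
  candidate σ f = σ , mapᵛ f (fromList (bridge Σ σ))

  candidatesFor : Database → TGD → List Candidate
  candidatesFor D σ = map (candidate σ) (assignments 0 (adom D Σ) (bridge Σ σ))

  candidates : Database → List Candidate
  candidates D = concatMap (candidatesFor D) Σ

  candidates-rule : ∀ D {x} → x ∈ candidates D → proj₁ x ∈ Σ
  candidates-rule D x∈ =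
    let σ , σ∈ , x∈σ = find (∈-concatMap⁻ (candidatesFor D) {xs = Σ} x∈)
        f , _ , eq   = ∈-map⁻ (candidate σ) {xs = assignments 0 (adom D Σ) (bridge Σ σ)} x∈σ
    in subst (_∈ Σ) (sym (cong proj₁ eq)) σ∈

  candidates-complete : ∀ D → σ ∈ Σ → (f : Var → Const) →
                        (∀ {v} → v ∈ bridge Σ σ → f v ∈ adom D Σ) →
                        candidate σ f ∈ candidates D
  candidates-complete {σ} D σ∈ f f∈ =
    let f′ , f′∈ , eq = assignments-complete 0 (adom D Σ) (bridge Σ σ) f (λ {v} → f∈ {v})
    in subst (_∈ candidates D) (cong (σ ,_) (map-cong-fromList (bridge Σ σ) (λ {v} → eq {v})))
         (∈-concatMap⁺ (candidatesFor D) {xs = Σ} (lose σ∈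
           (∈-map⁺ (candidate σ) {xs = assignments 0 (adom D Σ) (bridge Σ σ)} f′∈)))

  module _ (main? : ∀ F {n} (q : CQ n) c → Dec (CertainAnswer F (main 𝒜) q c)) (D : Database) where

    -- Candidates are handled through their indices, whose equality is decidable.
    Index : Set
    Index = Fin (length (candidates D))

    ruleOf : Index → TGD
    ruleOf = proj₁ ∘ lookupˡ (candidates D)

    tupleOf : ∀ i → Vec Const (length (bridge Σ (ruleOf i)))
    tupleOf = proj₂ ∘ lookupˡ (candidates D)

    fact : Index → Atom Const
    fact i = atom (Aux (ruleOf i)) (tupleOf i)

    facts : List Index → Database
    facts S = map fact S ++ D

    Certain : List Index → Index → Set₁
    Certain S i = CertainAnswer (facts S) (main 𝒜) (s-query Σ (ruleOf i)) (tupleOf i)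

    certain? : ∀ S i → Dec (Certain S i)
    certain? S i = main? (facts S) (s-query Σ (ruleOf i)) (tupleOf i)

    -- True brings the certain answers, which quantify over models, down to Set.
    Step : List Index → Index → Set
    Step S i = True (certain? S i)

    step? : ∀ S i → Dec (Step S i)
    step? S i = T? (isYes (certain? S i))

    -- More facts leave fewer models, so certain answers persist.
    step-mono : ∀ {S S′ i} → S ⊆ S′ → Step S i → Step S′ i
    step-mono {S} {S′} {i} S⊆S′ st = fromWitness {a? = certain? S′ i}
      (λ M F⊆M M⊨ → toWitness {a? = certain? S i} st M
        (Allₚ.anti-mono (++⁺ˡ D (map⁺ fact S⊆S′)) F⊆M) M⊨)

    closed⇒saturated : ∀ {S} → Closed Step S → Saturated D (facts S)
    closed⇒saturated {S} closed {σ} σ∈ f f∈ cert = ∈-++⁺ˡ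
      (subst (_∈ map fact S) (cong (λ (σ , c) → atom (Aux σ) c) (sym eq))
        (∈-map⁺ fact (closed {i} (fromWitness {a? = certain? S i} cert′))))
      where
      x∈ : candidate σ f ∈ candidates D
      x∈ = candidates-complete D σ∈ f f∈

      i : Index
      i = index x∈

      eq : candidate σ f ≡ lookupˡ (candidates D) i
      eq = lookup-index x∈

      cert′ : Certain S i
      cert′ = subst (λ (σ , c) → CertainAnswer (facts S) (main 𝒜) (s-query Σ σ) c) eq cert

    module _ (D-free : All AuxFree D) {M : Instance} (D⊆M : D ⊆ᴰ M) (M⊨Σ : M ⊨ Σ) where

      database-expansion : D ⊆ᴰ Expansion M
      database-expansion = All.tabulate λ α∈ → old (All.lookup D-free α∈) (All.lookup D⊆M α∈)

      facts-expansion : ∀ {S} → All (Expansion M ∘ mapAtom const ∘ fact) S → facts S ⊆ᴰ Expansion M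
      facts-expansion sound = Allₚ.++⁺ (Allₚ.map⁺ sound) database-expansion

      -- The expansion of `M` is a model of the facts found so far and of main(Σ), so it matches the
      -- s-atoms. These are free of auxiliary predicates, hence match in `M`, and the expansion
      -- contains the new fact by definition.
      step-sound : ∀ {S i} → All (Expansion M ∘ mapAtom const ∘ fact) S → Step S i →
                   Expansion M (mapAtom const (fact i))
      step-sound {S} {i} sound st =
        let h , eq , hs = toWitness {a? = certain? S i} st (Expansion M)
                            (facts-expansion sound) (expansion-model M⊨Σ)
            σ∈ = candidates-rule D (∈-lookup {xs = candidates D} i)
        in subst (Expansion M) (cong (atom (Aux (ruleOf i))) eq)
             (aux σ∈ (maps-expansion⁻ (s-atoms Σ (ruleOf i))
               (auxFree-body (s-atoms Σ (ruleOf i)) σ∈ (s-atoms⊆body Σ (ruleOf i))) hs))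

    auxFree-certain? : All AuxFree D → (q : CQ n) → All AuxFree (atoms q) → ∀ c →
                       Dec (CertainAnswer D Σ q c)
    auxFree-certain? D-free q q-free c =
      let S , ds , closed = saturation Step step? step-mono
      in map′
        -- For each model `M` the derivations of `S` are replayed in its expansion, to which the
        -- answer of the oracle then applies.
        (λ cert M D⊆M M⊨ → expansion-query⁻ {q = q} q-free
          (cert (Expansion M)
            (facts-expansion D-free D⊆M M⊨ (derivable-rec* Step (step-sound D-free D⊆M M⊨) ds))
            (expansion-model M⊨)))
        (saturated-complete {q = q} (∈-++⁺ʳ (map fact S)) (closed⇒saturated closed))
        (main? (facts S) q c)

-- Renaming the predicates that do not occur in the ontology

module _ (r : Pred → ℕ) where

  -- Arities are preserved, so the argument vector keeps its type.
  rename : Atom T → Atom T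
  rename (atom p ts) = atom (r p / arity p) ts

  vars-rename : ∀ φ → vars (map rename φ) ≡ vars φ
  vars-rename φ = concatMap-map atomVars rename φ

  renameQuery : CQ n → CQ n
  renameQuery q = record
    { answer = answer q
    ; atoms  = map rename (atoms q)
    ; safe   = λ {v} v∈ → subst (v ∈_) (sym (vars-rename (atoms q))) (safe q v∈)
    }

  Fixes : Ontology → Set
  Fixes Σ = ∀ {σ α} → σ ∈ Σ → α ∈ body σ ++ head σ → r (pred α) ≡ name (pred α)

  rename-fixed : (α : Atom T) → r (pred α) ≡ name (pred α) → rename α ≡ α
  rename-fixed (atom p ts) eq = cong (λ k → atom (k / arity p) ts) eq

  maps-rename : ∀ φ → (∀ {α} → α ∈ φ → r (pred α) ≡ name (pred α)) →
                (h maps φ into M → h maps φ into (M ∘ rename)) ×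
                (h maps φ into (M ∘ rename) → h maps φ into M)
  maps-rename {h} {M} φ fix =
    (λ hφ → All.tabulate λ {α} α∈ → subst M (sym (fixed α α∈)) (All.lookup hφ α∈)) ,
    (λ hφ → All.tabulate λ {α} α∈ → subst M (fixed α α∈) (All.lookup hφ α∈))
    where
    fixed : ∀ α → α ∈ φ → rename (mapAtom (h ⟪_⟫) α) ≡ mapAtom (h ⟪_⟫) α
    fixed α α∈ = rename-fixed (mapAtom (h ⟪_⟫) α) (fix α∈)

  rename-model : Fixes Σ → M ⊨ Σ → (M ∘ rename) ⊨ Σ
  rename-model {M = M} fix M⊨ {σ} σ∈ h hb =
    let h′ , eq , hh = M⊨ σ∈ h (proj₂ (maps-rename {M = M} (body σ) (fix σ∈ ∘ ∈-++⁺ˡ)) hb)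
    in h′ , eq , proj₁ (maps-rename {M = M} (head σ) (fix σ∈ ∘ ∈-++⁺ʳ (body σ))) hh

  -- A model of the renamed database is pulled back along the renaming, which fixes Σ and therefore
  -- yields a model of Σ.
  rename-certain : ∀ {q : CQ n} {c} → Fixes Σ →
                   CertainAnswer D Σ q c → CertainAnswer (map rename D) Σ (renameQuery q) c
  rename-certain fix cert M D⊆M M⊨ =
    let h , eq , hq = cert (M ∘ rename) (Allₚ.map⁻ D⊆M) (rename-model {M = M} fix M⊨)
    in h , eq , Allₚ.map⁺ hq

-- Pulling back along a left inverse `s` of `r` turns a model of `D` into one of the renamed
-- database.
unrename-certain : ∀ (r s : Pred → ℕ) {q : CQ n} {c} →
                   (∀ p → s (r p / arity p) ≡ name p) → Fixes s Σ →
                   CertainAnswer (map (rename r) D) Σ (renameQuery r q) c → CertainAnswer D Σ q c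
unrename-certain r s inv fix cert M D⊆M M⊨ =
  let h , eq , hq = cert (M ∘ rename s)
                      (Allₚ.map⁺ (All.map (λ {α} → subst M (sym (back (mapAtom const α)))) D⊆M))
                      (rename-model s {M = M} fix M⊨)
  in h , eq , All.map (λ {α} → subst M (back (mapAtom (h ⟪_⟫) α))) (Allₚ.map⁻ hq)
  where
  back : (α : Atom Ground) → rename s (rename r α) ≡ α
  back (atom p ts) = cong (λ k → atom (k / arity p) ts) (inv p)

module _ {Σ : Ontology} (𝒜 : AuxChoice Σ) where
  open AuxChoice 𝒜 using (auxName; Aux) renaming (fresh to aux-fresh)

  predicates : List Pred
  predicates = concatMap (λ σ → map pred (body σ ++ head σ)) Σ

  threshold : ℕ
  threshold = above (map name predicates ++ map auxName Σ)

  ∈-predicates : ∀ {α} → σ ∈ Σ → α ∈ body σ ++ head σ → pred α ∈ predicates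
  ∈-predicates σ∈ α∈ =
    ∈-concatMap⁺ (λ σ → map pred (body σ ++ head σ)) (lose σ∈ (∈-map⁺ pred α∈))

  name<threshold : ∀ {p} → p ∈ predicates → name p < threshold
  name<threshold p∈ = <above (∈-++⁺ˡ (∈-map⁺ name p∈))

  auxName<threshold : σ ∈ Σ → auxName σ < threshold
  auxName<threshold σ∈ = <above (∈-++⁺ʳ (map name predicates) (∈-map⁺ auxName σ∈))

  -- Names in Σ and auxiliary names lie below `threshold`; foreign predicates are moved to or above
  -- it, so comparison with `threshold` tells how to undo the shift.
  shift unshift : Pred → ℕ
  shift p with p ∈ᵖ? predicates
  ... | yes _ = name p
  ... | no  _ = threshold + name p
  unshift p with name p <? threshold
  ... | yes _ = name p
  ... | no  _ = name p ∸ threshold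

  shift-fixes : Fixes shift Σ
  shift-fixes {α = α} σ∈ α∈ with pred α ∈ᵖ? predicates
  ... | yes _ = refl
  ... | no p∉ = contradiction (∈-predicates σ∈ α∈) p∉

  unshift-fixes : Fixes unshift Σ
  unshift-fixes {α = α} σ∈ α∈ with name (pred α) <? threshold
  ... | yes _ = refl
  ... | no p≮ = contradiction (name<threshold (∈-predicates σ∈ α∈)) p≮

  unshift-shift : ∀ p → unshift (shift p / arity p) ≡ name p
  unshift-shift p with p ∈ᵖ? predicates
  ... | yes p∈ with name p <? threshold
  ...   | yes _ = refl
  ...   | no p≮ = contradiction (name<threshold p∈) p≮
  unshift-shift p | no _ with threshold + name p <? threshold
  ...   | yes p< = contradiction p< (m+n≮m threshold (name p))
  ...   | no _   = m+n∸m≡n threshold (name p)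

  shift-cases : ∀ p → (p ∈ predicates × shift p ≡ name p) ⊎ shift p ≡ threshold + name p
  shift-cases p with p ∈ᵖ? predicates
  ... | yes p∈ = inj₁ (p∈ , refl)
  ... | no _   = inj₂ refl

  -- A predicate of Σ differs from `Aux σ` by freshness; a shifted one has too large a name.
  shift≢aux : ∀ p → σ ∈ Σ → shift p / arity p ≢ Aux σ
  shift≢aux {σ} p σ∈ eq = [ kept , shifted ]′ (shift-cases p)
    where
    kept : ¬ (p ∈ predicates × shift p ≡ name p)
    kept (p∈ , fixed) =
      let τ , τ∈ , p∈τ = find (∈-concatMap⁻ (λ σ → map pred (body σ ++ head σ)) {xs = Σ} p∈)
          α , α∈ , p≡  = ∈-map⁻ pred p∈τ
      in aux-fresh σ∈ τ∈ α∈ (trans (sym p≡) (trans (cong (_/ arity p) (sym fixed)) eq))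

    shifted : shift p ≢ threshold + name p
    shifted p≡ = m+n≮m threshold (name p)
      (subst (_< threshold) (trans (sym (cong name eq)) p≡) (auxName<threshold σ∈))

  shift-auxFree : (φ : List (Atom T)) → All (AuxFree 𝒜) (map (rename shift) φ)
  shift-auxFree φ = Allₚ.map⁺ (All.tabulate λ {α} _ → shift≢aux (pred α))

  dyadic-certain? : (∀ F {n} (q : CQ n) c → Dec (CertainAnswer F (main 𝒜) q c)) →
                    ∀ D {n} (q : CQ n) c → Dec (CertainAnswer D Σ q c)
  dyadic-certain? main? D q c = map′
    (unrename-certain shift unshift {q = q} unshift-shift unshift-fixes)
    (rename-certain shift {q = q} shift-fixes)
    (auxFree-certain? 𝒜 main? (map (rename shift) D) (shift-auxFree D)
      (renameQuery shift q) (shift-auxFree (atoms q)) c)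

mainTheorem8 : ∀ {ℓ : Level} (𝒞 : OntologyClass ℓ) → CertEvalDecidable 𝒞 → CertEvalDecidable (Dyadic 𝒞)
mainTheorem8 𝒞 decide D Σ (inj₁ Σ∈𝒞)          q c = decide D Σ Σ∈𝒞 q c
mainTheorem8 𝒞 decide D Σ (inj₂ (𝒜 , main∈𝒞)) q c =
  dyadic-certain? 𝒜 (λ F → decide F (main 𝒜) main∈𝒞) D q c
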